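{- Let $x_1x_2x_3\cdots$ be the binary Ehrenfeucht–Mycielski sequence, and let $x\in\{0,1\}^+$ be a fixed nonempty binary string. Then, as $n\to\infty$, $$|T_n(x)| = |R_n(x)| = N_n(x) + o(n).$$
   Context: The Ehrenfeucht–Mycielski (EM) sequence $x_1x_2x_3\cdots\in\{0,1\}^{\mathbb N}$ is defined by $x_1x_2x_3=010$ and, for $n\ge 3$: let $w$ be the longest suffix of $x_1^n=x_1\cdots x_n$ that also occurs in $x_1^n$ ending at some position $j<n$; choose the largest such $j$; then $x_{n+1}=1-x_{j+1}$. For $i\le j$, $x_i^j$ denotes $x_i\cdots x_j$. $N_n(w)$ denotes the number of positions $i$ with $i+|w|-1\le n$ and $x_i^{i+|w|-1}=w$ (occurrences may overlap). $R_n$ is the set of strings in $\{0,1\}^*$ (including the empty string) that occur at least twice as substrings of $x_1^n$. $R_n(x)$ is the set of strings in $R_n$ having $x$ as a suffix. $T_n$ is the rooted tree with vertex set $R_n$, root the empty string, in which each nonempty $w=bW\in R_n$ ($b$ a bit) is a child of $W$ via an edge labelled $b$, so that the edge labels read along the path from a vertex to the root spell that vertex's string. $T_n(x)$ is the subtree of $T_n$ consisting of the vertices whose strings end with $x$, and $|T|$ denotes the number of vertices of a tree $T$. The notation $f(n)=g(n)+o(n)$ means $(f(n)-g(n))/n\to 0$. -}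

module Defs where

open import Data.Bool using (Bool; true; false; not; if_then_else_)
import Data.Bool as B
open import Data.Nat using (ℕ; zero; suc; _+_; _∸_; _≤_; _≤?_)
open import Data.List using (List; []; _∷_; _++_; [_]; length; take; drop; filter; upTo; map; concat; concatMap)
open import Data.List.Properties using (≡-dec)
open import Data.Maybe using (Maybe; just; nothing)
open import Data.Product using (_×_)
open import Relation.Nullary using (does; _×-dec_)
open import Relation.Binary.PropositionalEquality using (_≡_)
open import Data.List.Relation.Binary.Suffix.Heterogeneous using (Suffix)
open import Data.List.Relation.Binary.Suffix.Heterogeneous.Properties using (suffix?)

-- Binary strings; the bit 0 is 'false' and the bit 1 is 'true'.
Str : Set
Str = List Bool

_≟s_ : (u v : Str) → Relation.Nullary.Dec (u ≡ v)
_≟s_ = ≡-dec B._≟_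

sub : Str → ℕ → ℕ → Str
sub s i L = take L (drop i s)

-- 1-based j-th bit of s (default false if out of range)
bitAt : Str → ℕ → Bool
bitAt s j with drop (j ∸ 1) s
... | []    = false
... | b ∷ _ = b

-- The EM rule.  For s = x_1^n: scan suffix lengths L = n-1, n-2, …, 0
-- (longest first), and for each L scan end positions j = n-1, …, L
-- (largest first) for an occurrence x_{j-L+1}^j of the length-L suffix.
-- The first hit gives the longest w and the largest j; x_{n+1} = 1 - x_{j+1}.

tryJ : Str → Str → ℕ → ℕ → Maybe ℕ
tryJ s w L zero    = if does (sub s (L ∸ L) L ≟s w) then just L else nothing
tryJ s w L (suc k) =
  if does (sub s ((L + suc k) ∸ L) L ≟s w) then just (L + suc k) else tryJ s w L k

tryLen : Str → ℕ → Maybe ℕ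
tryLen s L with tryJ s (drop (length s ∸ L) s) L ((length s ∸ 1) ∸ L)
tryLen s L       | just j  = just j
tryLen s zero    | nothing = nothing
tryLen s (suc m) | nothing = tryLen s m

nextBit : Str → Bool
nextBit s with tryLen s (length s ∸ 1)
... | just j  = not (bitAt s (suc j))
... | nothing = false   -- never happens for n ≥ 1 (L = 0, j = n-1 always matches)

emPrefix : ℕ → Str
emPrefix zero = []
emPrefix (suc zero) = false ∷ []
emPrefix (suc (suc zero)) = false ∷ true ∷ []
emPrefix (suc (suc (suc zero))) = false ∷ true ∷ false ∷ []
emPrefix (suc (suc (suc (suc m)))) =
  let s = emPrefix (suc (suc (suc m))) in s ++ [ nextBit s ]

occ : Str → Str → ℕ
occ s w = length (filter (λ i → sub s i (length w) ≟s w)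
                         (upTo (suc (length s ∸ length w))))

N : ℕ → Str → ℕ
N n w = occ (emPrefix n) w

stringsOfLen : ℕ → List Str
stringsOfLen zero    = [] ∷ []
stringsOfLen (suc L) = concatMap (λ w → (false ∷ w) ∷ (true ∷ w) ∷ []) (stringsOfLen L)

stringsUpTo : ℕ → List Str
stringsUpTo L = concatMap stringsOfLen (upTo (suc L))

IsSuffix : Str → Str → Set
IsSuffix x w = Suffix _≡_ x w

isSuffix? : (x w : Str) → Relation.Nullary.Dec (IsSuffix x w)
isSuffix? = suffix? B._≟_

-- R_n : strings occurring at least twice in x_1^n (such strings have length ≤ n,
-- so all of them appear in stringsUpTo n, each exactly once)
Rn : ℕ → List Str
Rn n = filter (λ w → 2 ≤? N n w) (stringsUpTo n)

RnOf : ℕ → Str → List Str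
RnOf n x = filter (λ w → (2 ≤? N n w) ×-dec isSuffix? x w) (stringsUpTo n)

-- The tree T_n: vertex set R_n, root [], and each nonempty vertex b ∷ W
-- has parent W (edge labelled b).
parent : Str → Str
parent []      = []
parent (_ ∷ W) = W

TnOfVertices : ℕ → Str → List Str
TnOfVertices n x = filter (isSuffix? x) (Rn n)

dist : ℕ → ℕ → ℕ
dist a b = (a ∸ b) + (b ∸ a)

{-# OPTIONS --safe #-}

-- Let w_m be the longest suffix of x_1^m that occurs earlier. If w_m = w_m' with m < m', then the
-- bits to the left of the two copies differ, so the earlier copy of w_m can only be a prefix of the
-- sequence. Hence m ↦ w_m is injective up to prefixes, each of which is taken at most twice. If x is
-- a suffix of x_1^m occurring earlier, then x is a suffix of w_m, and conversely.
--
-- The first two occurrences of a word are followed by different bits, so a repeated word is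
-- determined by the start of its second occurrence, and |R_n| ≤ n + 1. Apply the injection to the
-- times at which x_1^m ends with x, and to those at which it does not: as there are about n times
-- and at most n + 1 repeated words altogether, |R_n(x)| and N_n(x) differ at most by |x| plus a
-- multiple of the length of the longest repeated prefix.
--
-- This length is O(√n): a word whose second occurrence starts at q has length at most q (0-based),
-- so in a prefix of length 3h the words of length at least h that start before h are distinct; if
-- the prefix is repeated, these h² words all belong to R_n.
module Submission where

open import Defs
open import Data.Bool using (Bool; true; false; not)
import Data.Bool as Bool
open import Data.Bool.Properties using (not-¬; ¬-not)
open import Data.Fin using (Fin; zero; suc)
open import Data.Fin.Properties using (injective⇒≤)
open import Data.List using (List; []; _∷_; _++_; [_]; length; lookup; take; drop; filter; map; upTo; applyUpTo; cartesianProduct; concatMap)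
open import Data.List.Properties using (length-applyUpTo; applyUpTo-∷ʳ; length-upTo; length-++; length-map; drop-all; take++drop≡id; ∷-injective)
open import Data.List.Membership.Propositional using (_∈_)
open import Data.List.Membership.Propositional.Properties
open import Data.List.Relation.Binary.Pointwise using (Pointwise-≡⇒≡; ≡⇒Pointwise-≡)
open import Data.List.Relation.Binary.Suffix.Heterogeneous as Suffix using (toView; here; _++ˢ_)
open import Data.List.Relation.Unary.All as All using ([]; _∷_)
import Data.List.Relation.Unary.All.Properties as All
open import Data.List.Relation.Unary.AllPairs as AllPairs using ([]; _∷_)
import Data.List.Relation.Unary.AllPairs.Properties as AllPairs
open import Data.List.Relation.Unary.Any using (here; there; index)
open import Data.List.Relation.Unary.Any.Properties using (lookup-index)
open import Data.List.Relation.Unary.Unique.Propositional using (Unique)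
open import Data.List.Relation.Unary.Unique.Propositional.Properties as Unique using (cartesianProduct⁺; upTo⁺)
open import Data.Maybe using (just; nothing)
open import Data.Nat
open import Data.Nat.DivMod using (_/_; _%_; m/n*n≤m; m≡m%n+[m/n]*n; m%n<n; m*n/n≡m; /-monoˡ-≤)
open import Data.Nat.Induction using (<-wellFounded)
open import Data.Nat.Properties
open import Data.Nat.Solver using (module +-*-Solver)
open import Data.Product using (_×_; _,_; ∃-syntax; proj₁; proj₂; uncurry)
open import Data.Sum using (_⊎_; inj₁; inj₂)
open import Function using (_∘_)
open import Induction.WellFounded using (Acc; acc)
open import Relation.Binary.Definitions using (tri<; tri≈; tri>)
open import Relation.Binary.PropositionalEquality hiding ([_])
open import Relation.Nullary using (¬_; Dec; yes; no; contradiction; ¬?; _×-dec_)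
open import Relation.Nullary.Decidable using (map′)
open import Relation.Unary using (Decidable)
open +-*-Solver using (solve; _:=_; _:+_; _:*_; con)

-- The sequence as a function of a 0-based index, and its words.

opaque

  -- The letter x_{n+1} of the sequence is `X n`. The second and third prescribed letters obey the
  -- rule as well, so only the first one is a separate case.
  X : ℕ → Bool
  X zero    = false
  X (suc n) = nextBit (emPrefix (suc n))

  X-suc : ∀ n → X (suc n) ≡ nextBit (emPrefix (suc n))
  X-suc n = refl

  emPrefix≡ : ∀ n → emPrefix n ≡ applyUpTo X n
  emPrefix≡ zero = refl
  emPrefix≡ (suc zero) = refl
  emPrefix≡ (suc n@(suc m)) =
    trans (emPrefix-suc m) (trans (cong (_++ [ X n ]) (emPrefix≡ n)) (applyUpTo-∷ʳ X n))
    where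
    emPrefix-suc : ∀ m → emPrefix (2 + m) ≡ emPrefix (1 + m) ++ [ X (1 + m) ]
    emPrefix-suc zero          = refl
    emPrefix-suc (suc zero)    = refl
    emPrefix-suc (suc (suc m)) = refl

length-emPrefix : ∀ n → length (emPrefix n) ≡ n
length-emPrefix n = trans (cong length (emPrefix≡ n)) (length-applyUpTo X n)

word : ℕ → ℕ → Str
word a l = applyUpTo (λ i → X (a + i)) l

length-word : ∀ a l → length (word a l) ≡ l
length-word a l = length-applyUpTo _ l

Agree : ℕ → ℕ → ℕ → Set
Agree a b l = ∀ i → i < l → X (a + i) ≡ X (b + i)

module _ {A : Set} where

  applyUpTo-cong : {f g : ℕ → A} → ∀ l → (∀ i → i < l → f i ≡ g i) → applyUpTo f l ≡ applyUpTo g l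
  applyUpTo-cong zero    eq = refl
  applyUpTo-cong (suc l) eq = cong₂ _∷_ (eq 0 z<s) (applyUpTo-cong l (λ i i<l → eq (suc i) (s<s i<l)))

  applyUpTo-injective : {f g : ℕ → A} → ∀ l → applyUpTo f l ≡ applyUpTo g l → ∀ i → i < l → f i ≡ g i
  applyUpTo-injective (suc l) eq zero    _         = proj₁ (∷-injective eq)
  applyUpTo-injective (suc l) eq (suc i) (s≤s i<l) = applyUpTo-injective l (proj₂ (∷-injective eq)) i i<l

  take-applyUpTo : (f : ℕ → A) → ∀ {l n} → l ≤ n → take l (applyUpTo f n) ≡ applyUpTo f l
  take-applyUpTo f z≤n       = refl
  take-applyUpTo f (s≤s l≤n) = cong (f 0 ∷_) (take-applyUpTo (f ∘ suc) l≤n)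

  drop-applyUpTo : (f : ℕ → A) → ∀ a l → drop a (applyUpTo f (a + l)) ≡ applyUpTo (λ i → f (a + i)) l
  drop-applyUpTo f zero    l = refl
  drop-applyUpTo f (suc a) l = drop-applyUpTo (f ∘ suc) a l

word-cong : ∀ a b l → Agree a b l → word a l ≡ word b l
word-cong a b l = applyUpTo-cong l

word-injective : ∀ a b l → word a l ≡ word b l → Agree a b l
word-injective a b l = applyUpTo-injective l

sub-emPrefix : ∀ n a l → a + l ≤ n → sub (emPrefix n) a l ≡ word a l
sub-emPrefix n a l a+l≤n = begin
  take l (drop a (emPrefix n))               ≡⟨ cong (take l ∘ drop a) (emPrefix≡ n) ⟩
  take l (drop a (applyUpTo X n))            ≡⟨ cong (take l ∘ drop a ∘ applyUpTo X) (m+[n∸m]≡n a≤n) ⟨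
  take l (drop a (applyUpTo X (a + (n ∸ a)))) ≡⟨ cong (take l) (drop-applyUpTo X a (n ∸ a)) ⟩
  take l (word a (n ∸ a))                    ≡⟨ take-applyUpTo _ (m+n≤o⇒m≤o∸n l (subst (_≤ n) (+-comm a l) a+l≤n)) ⟩
  word a l                                   ∎
  where
  open ≡-Reasoning
  a≤n = m+n≤o⇒m≤o a a+l≤n

drop-emPrefix : ∀ a l → drop a (emPrefix (a + l)) ≡ word a l
drop-emPrefix a l = trans (cong (drop a) (emPrefix≡ (a + l))) (drop-applyUpTo X a l)

bitAt-emPrefix : ∀ n j → j < n → bitAt (emPrefix n) (suc j) ≡ X j
bitAt-emPrefix n j j<n rewrite emPrefix≡ n = go X n j j<n
  where
  go : ∀ f n j → j < n → bitAt (applyUpTo f n) (suc j) ≡ f j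
  go f (suc n) zero    _         = refl
  go f (suc n) (suc j) (s≤s j<n) = go (f ∘ suc) n j j<n

-- Correctness of the search for the longest match.

tryJ-just : ∀ s w L k {j} → tryJ s w L k ≡ just j → ∃[ a ] a ≤ k × j ≡ L + a × sub s a L ≡ w
tryJ-just s w L zero eq with sub s (L ∸ L) L ≟s w
tryJ-just s w L zero refl | yes p = 0 , z≤n , sym (+-identityʳ L) , subst (λ a → sub s a L ≡ w) (n∸n≡0 L) p
tryJ-just s w L (suc k) eq with sub s ((L + suc k) ∸ L) L ≟s w
tryJ-just s w L (suc k) refl | yes p = suc k , ≤-refl , refl , subst (λ a → sub s a L ≡ w) (m+n∸m≡n L (suc k)) p
tryJ-just s w L (suc k) eq   | no _ with a , a≤k , rest ← tryJ-just s w L k eq = a , m≤n⇒m≤1+n a≤k , rest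

tryJ-nothing : ∀ s w L k → tryJ s w L k ≡ nothing → ∀ a → a ≤ k → sub s a L ≢ w
tryJ-nothing s w L zero eq a a≤0 p with sub s (L ∸ L) L ≟s w
... | no ¬p rewrite n≤0⇒n≡0 a≤0 = ¬p (subst (λ a → sub s a L ≡ w) (sym (n∸n≡0 L)) p)
tryJ-nothing s w L (suc k) eq a a≤1+k p with sub s ((L + suc k) ∸ L) L ≟s w
... | no ¬p with a ≟ suc k
...   | yes refl = ¬p (subst (λ a → sub s a L ≡ w) (sym (m+n∸m≡n L (suc k))) p)
...   | no a≢    = tryJ-nothing s w L k eq a (s≤s⁻¹ (≤∧≢⇒< a≤1+k a≢)) p

-- For `l < n`, a copy starting at `a ≤ (n ∸ 1) ∸ l` is one that ends before the last of the `n`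
-- letters, so this says that the suffix of length `l` has no earlier occurrence.
Missed : ℕ → Str → ℕ → Set
Missed n s l = ∀ a → a ≤ (n ∸ 1) ∸ l → sub s a l ≢ drop (n ∸ l) s

tryLen-just : ∀ s L {j} → tryLen s L ≡ just j →
  ∃[ l ] ∃[ a ] l ≤ L × a ≤ (length s ∸ 1) ∸ l × j ≡ l + a × sub s a l ≡ drop (length s ∸ l) s ×
  (∀ l′ → l < l′ → l′ ≤ L → Missed (length s) s l′)
tryLen-just s L eq with tryJ s (drop (length s ∸ L) s) L ((length s ∸ 1) ∸ L) in eqJ
tryLen-just s L refl | just j
  with a , a≤ , j≡ , m ← tryJ-just s _ L _ eqJ
  = L , a , ≤-refl , a≤ , j≡ , m , λ l′ L<l′ l′≤L → contradiction l′≤L (<⇒≱ L<l′)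
tryLen-just s (suc L) eq | nothing
  with l , a , l≤L , a≤ , j≡ , m , missed ← tryLen-just s L eq
  = l , a , m≤n⇒m≤1+n l≤L , a≤ , j≡ , m , longer
  where
  longer : ∀ l′ → l < l′ → l′ ≤ suc L → Missed (length s) s l′
  longer l′ l<l′ l′≤ with l′ ≟ suc L
  ... | yes refl = tryJ-nothing s _ (suc L) _ eqJ
  ... | no l′≢   = missed l′ l<l′ (s≤s⁻¹ (≤∧≢⇒< l′≤ l′≢))

tryLen-nothing : ∀ s L → tryLen s L ≡ nothing → Missed (length s) s 0
tryLen-nothing s L eq with tryJ s (drop (length s ∸ L) s) L ((length s ∸ 1) ∸ L) in eqJ
tryLen-nothing s zero    eq | nothing = tryJ-nothing s _ zero _ eqJ
tryLen-nothing s (suc L) eq | nothing = tryLen-nothing s L eq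

-- The longest suffix of X 0 … X n that occurs earlier. It has positive start suc left,
-- because an earlier copy starts before it; X left is the bit to its left.
record LongestMatch (n : ℕ) : Set where
  field
    len earlier left : ℕ
    ends    : left + len ≡ n
    before  : earlier ≤ left
    agree   : Agree earlier (suc left) len
    flips   : X (suc n) ≡ not (X (earlier + len))
    longest : ∀ a b l → a ≤ b → b + l ≡ n → Agree a (suc b) l → l ≤ len

nextBit-spec : ∀ s n → length s ≡ suc n → ∃[ l ] ∃[ a ] l ≤ n × a ≤ n ∸ l ×
  nextBit s ≡ not (bitAt s (suc (a + l))) × sub s a l ≡ drop (suc n ∸ l) s ×
  (∀ l′ → l < l′ → l′ ≤ n → Missed (suc n) s l′)
nextBit-spec s@(_ ∷ s′) .(length s′) refl with tryLen s (length s′) in eq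
-- The empty suffix always matches, so the search cannot fail.
... | nothing = contradiction (sym (drop-length s)) (tryLen-nothing s (length s′) eq 0 z≤n)
  where
  drop-length : ∀ (s : Str) → drop (length s) s ≡ []
  drop-length s = drop-all (length s) s ≤-refl
... | just j with l , a , l≤ , a≤ , refl , m , missed ← tryLen-just s (length s′) eq
  = l , a , l≤ , a≤ , cong (λ j → not (bitAt s (suc j))) (+-comm l a) , m , missed

longestMatch : ∀ n → LongestMatch n
longestMatch n with l , a , l≤n , a≤ , next , m , missed ← nextBit-spec (emPrefix (suc n)) n (length-emPrefix (suc n))
  = record
  { len     = l
  ; earlier = a
  ; left    = n ∸ l
  ; ends    = m∸n+n≡m l≤n
  ; before  = a≤
  ; agree   = word-injective a (suc (n ∸ l)) l (trans (sym (sub-emPrefix (suc n) a l (m≤n⇒m≤1+n (a+l≤n l≤n a≤))))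
                (trans m (suffix-word l l≤n)))
  ; flips   = trans (X-suc n) (trans next (cong not (bitAt-emPrefix (suc n) (a + l) (s≤s (a+l≤n l≤n a≤)))))
  ; longest = longest missed
  }
  where
  a+l≤n : ∀ {a l} → l ≤ n → a ≤ n ∸ l → a + l ≤ n
  a+l≤n {a} = m≤o∸n⇒m+n≤o a
  suffix-word : ∀ l → l ≤ n → drop (suc n ∸ l) (emPrefix (suc n)) ≡ word (suc (n ∸ l)) l
  suffix-word l l≤n = subst₂ (λ d m → drop d (emPrefix m) ≡ word (suc (n ∸ l)) l)
    (sym (+-∸-assoc 1 l≤n)) (cong suc (m∸n+n≡m l≤n)) (drop-emPrefix (suc (n ∸ l)) l)
  longest : ∀ {l} → (∀ l′ → l < l′ → l′ ≤ n → Missed (suc n) (emPrefix (suc n)) l′) →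
    ∀ a b l′ → a ≤ b → b + l′ ≡ n → Agree a (suc b) l′ → l′ ≤ l
  longest {l} missed a b l′ a≤b refl agree with l′ ≤? l
  ... | yes p = p
  ... | no ¬p = contradiction
    (trans (sub-emPrefix (suc n) a l′ (m≤n⇒m≤1+n (+-monoˡ-≤ l′ a≤b)))
      (trans (word-cong a (suc b) l′ agree) (sym (trans (suffix-word l′ (m≤n+m l′ b)) (cong (λ d → word (suc d) l′) (m+n∸n≡m b l′))))))
    (missed l′ (≰⇒> ¬p) (m≤n+m l′ b) a (subst (a ≤_) (sym (m+n∸n≡m b l′)) a≤b))

-- Agreement of windows, and overlapping repetitions.

agree? : ∀ a b l → Dec (Agree a b l)
agree? a b l = map′ (word-injective a b l) (word-cong a b l) (word a l ≟s word b l)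

agree-sym : ∀ {a b l} → Agree a b l → Agree b a l
agree-sym ab i i<l = sym (ab i i<l)

agree-trans : ∀ {a b c l} → Agree a b l → Agree b c l → Agree a c l
agree-trans ab bc i i<l = trans (ab i i<l) (bc i i<l)

agree-≤ : ∀ {a b l m} → l ≤ m → Agree a b m → Agree a b l
agree-≤ l≤m ab i i<l = ab i (<-≤-trans i<l l≤m)

agree-shift : ∀ a b k l → Agree a b (k + l) → Agree (a + k) (b + k) l
agree-shift a b k l ab i i<l = begin
  X (a + k + i)   ≡⟨ cong X (+-assoc a k i) ⟩
  X (a + (k + i)) ≡⟨ ab (k + i) (+-monoʳ-< k i<l) ⟩
  X (b + (k + i)) ≡⟨ cong X (+-assoc b k i) ⟨
  X (b + k + i)   ∎
  where open ≡-Reasoning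

agree-left : ∀ {a b l} → X a ≡ X b → Agree (suc a) (suc b) l → Agree a b (suc l)
agree-left {a} {b} eq ab zero    _ = subst₂ (λ a b → X a ≡ X b) (sym (+-identityʳ a)) (sym (+-identityʳ b)) eq
agree-left {a} {b} eq ab (suc i) (s≤s i<l) =
  subst₂ (λ a b → X a ≡ X b) (sym (+-suc a i)) (sym (+-suc b i)) (ab i i<l)

-- Agreement of p and q on l bits is a period q − p of the window from p to q + l. If l > q, then
-- the longest match at time 2q reaches back to position q, hence gives a second period d ≤ q, and
-- X (2q) = X (2q − (q − p)) = X (2q − (q − p) − d) = X (2q − d), against the choice of X (2q).
agree⇒length≤ : ∀ {p q l} → p < q → Agree p q l → l ≤ q
agree⇒length≤ {p} {suc q} {l} p<q agree with l ≤? suc q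
... | yes l≤q = l≤q
... | no l≰q  = contradiction flips (not-¬ same)
  where
  open LongestMatch (longestMatch (q + suc q)) renaming (agree to match)
  -- Here `d` is the first period. The offset `k` in the match is the position `p + suc q`, which
  -- lies `d` before the next bit; `earlier + r` is where the last `suc q` letters of the earlier
  -- copy begin.
  d r k : ℕ
  d = suc q ∸ p
  r = len ∸ suc q
  k = p + r
  d+p≡ : d + p ≡ suc q
  d+p≡ = m∸n+n≡m (<⇒≤ p<q)
  q<l : suc q < l
  q<l = ≰⇒> l≰q
  r+q≡len : r + suc q ≡ len
  r+q≡len = m∸n+n≡m (longest p q (suc q) (s≤s⁻¹ p<q) refl (agree-≤ (<⇒≤ q<l) agree))
  d+k≡len : d + k ≡ len
  d+k≡len = begin
    d + (p + r) ≡⟨ +-assoc d p r ⟨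
    d + p + r   ≡⟨ cong (_+ r) d+p≡ ⟩
    suc q + r   ≡⟨ +-comm (suc q) r ⟩
    r + suc q   ≡⟨ r+q≡len ⟩
    len         ∎
    where open ≡-Reasoning
  left+k≡ : suc (left + k) ≡ p + suc q
  left+k≡ = +-cancelˡ-≡ d _ _ (begin
    d + suc (left + k)   ≡⟨ solve 3 (λ d b k → d :+ (con 1 :+ (b :+ k)) := con 1 :+ (b :+ (d :+ k))) refl d left k ⟩
    suc (left + (d + k)) ≡⟨ cong (λ m → suc (left + m)) d+k≡len ⟩
    suc (left + len)     ≡⟨ cong suc ends ⟩
    suc q + suc q        ≡⟨ cong (_+ suc q) d+p≡ ⟨
    d + p + suc q        ≡⟨ +-assoc d p (suc q) ⟩
    d + (p + suc q)      ∎)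
    where open ≡-Reasoning
  k<len : k < len
  k<len = subst (k <_) d+k≡len (m<n+m k (m<n⇒0<n∸m p<q))
  earlier+r≤q : earlier + r ≤ q
  earlier+r≤q = +-cancelʳ-≤ (suc q) _ _ (begin
    earlier + r + suc q   ≡⟨ +-assoc earlier r (suc q) ⟩
    earlier + (r + suc q) ≡⟨ cong (earlier +_) r+q≡len ⟩
    earlier + len         ≤⟨ +-monoˡ-≤ len before ⟩
    left + len            ≡⟨ ends ⟩
    q + suc q             ∎)
    where open ≤-Reasoning
  same : X (suc q + suc q) ≡ X (earlier + len)
  same = begin
    X (suc q + suc q)         ≡⟨ agree (suc q) q<l ⟨
    X (p + suc q)             ≡⟨ cong X left+k≡ ⟨
    X (suc left + k)          ≡⟨ match k k<len ⟨
    X (earlier + k)           ≡⟨ cong X (solve 3 (λ e p r → e :+ (p :+ r) := p :+ (e :+ r)) refl earlier p r) ⟩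
    X (p + (earlier + r))     ≡⟨ agree (earlier + r) (<-trans (s≤s earlier+r≤q) q<l) ⟩
    X (suc q + (earlier + r)) ≡⟨ cong X (solve 3 (λ q e r → q :+ (e :+ r) := e :+ (r :+ q)) refl (suc q) earlier r) ⟩
    X (earlier + (r + suc q)) ≡⟨ cong (λ m → X (earlier + m)) r+q≡len ⟩
    X (earlier + len)         ∎
    where open ≡-Reasoning

-- Second occurrences determine repeated words.

-- The second occurrence of word q l starts at q.
Second : ℕ → ℕ → Set
Second q l = (∃[ p ] p < q × Agree p q l) ×
             (∀ p p′ → p < q → p′ < q → Agree p q l → Agree p′ q l → p ≡ p′)

-- As long as two distinct copies precede `q`, the later of them replaces `q`; this descent stops at
-- the second occurrence.
second-exists : ∀ {p q l} → p < q → Agree p q l → ∃[ r ] r ≤ q × Second r l × Agree r q l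
second-exists {p} {q} {l} p<q agree = go p q p<q agree (<-wellFounded q)
  where
  go : ∀ p q → p < q → Agree p q l → Acc _<_ q → ∃[ r ] r ≤ q × Second r l × Agree r q l
  go p q p<q agree (acc rec) with anyUpTo? (λ p′ → ¬? (p′ ≟ p) ×-dec agree? p′ q l) q
  ... | no none = q , ≤-refl , ((p , p<q , agree) , only) , λ _ _ → refl
    where
    is-p : ∀ p′ → p′ < q → Agree p′ q l → p′ ≡ p
    is-p p′ p′<q ag with p′ ≟ p
    ... | yes eq = eq
    ... | no ¬eq = contradiction (p′ , p′<q , ¬eq , ag) none
    only : ∀ p₁ p₂ → p₁ < q → p₂ < q → Agree p₁ q l → Agree p₂ q l → p₁ ≡ p₂
    only p₁ p₂ lt₁ lt₂ ag₁ ag₂ = trans (is-p p₁ lt₁ ag₁) (sym (is-p p₂ lt₂ ag₂))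
  ... | yes (p′ , p′<q , p′≢p , agree′) with <-cmp p p′
  ...   | tri≈ _ eq _ = contradiction (sym eq) p′≢p
  ...   | tri< p<p′ _ _ = let r , r≤ , sec , ag = go p p′ p<p′ (agree-trans {b = q} agree (agree-sym {p′} agree′)) (rec p′<q)
                          in r , ≤-trans r≤ (<⇒≤ p′<q) , sec , agree-trans {b = p′} ag agree′
  ...   | tri> _ _ p′<p = let r , r≤ , sec , ag = go p′ p p′<p (agree-trans {b = q} agree′ (agree-sym {p} agree)) (rec p<q)
                          in r , ≤-trans r≤ (<⇒≤ p<q) , sec , agree-trans {b = p} ag agree

-- The bits after the first two occurrences differ, so no proper extension of the second one occurs
-- earlier.
second-≮ : ∀ {q l m} → Second q l → Second q m → ¬ l < m
second-≮ {suc q} {l} {m} (_ , only) ((p , p<q , agree) , _) l<m = contradiction flips (not-¬ same)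
  where
  open LongestMatch (longestMatch (q + l)) renaming (agree to match)
  r : ℕ
  r = len ∸ l
  agreeₗ : Agree p (suc q) l
  agreeₗ = agree-≤ (<⇒≤ l<m) agree
  r+l≡len : r + l ≡ len
  r+l≡len = m∸n+n≡m (longest p q l (s≤s⁻¹ p<q) refl agreeₗ)
  left+r≡q : left + r ≡ q
  left+r≡q = +-cancelʳ-≡ l _ _ (trans (+-assoc left r l) (trans (cong (left +_) r+l≡len) ends))
  -- The last `l` letters of the earlier copy are an occurrence of the word before `suc q`; there is
  -- only one, the one at `p`.
  earlier+r≡p : earlier + r ≡ p
  earlier+r≡p = only _ _
    (s≤s (subst (earlier + r ≤_) left+r≡q (+-monoˡ-≤ r before))) p<q
    (subst (λ b → Agree (earlier + r) (suc b) l) left+r≡q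
      (agree-shift earlier (suc left) r l (subst (Agree earlier (suc left)) (sym r+l≡len) match)))
    agreeₗ
  same : X (suc q + l) ≡ X (earlier + len)
  same = begin
    X (suc q + l)         ≡⟨ agree l l<m ⟨
    X (p + l)             ≡⟨ cong (λ a → X (a + l)) earlier+r≡p ⟨
    X (earlier + r + l)   ≡⟨ cong X (+-assoc earlier r l) ⟩
    X (earlier + (r + l)) ≡⟨ cong (λ k → X (earlier + k)) r+l≡len ⟩
    X (earlier + len)     ∎
    where open ≡-Reasoning

second-injective : ∀ {q l m} → Second q l → Second q m → l ≡ m
second-injective {l = l} {m} s t with <-cmp l m
... | tri< l<m _ _ = contradiction l<m (second-≮ s t)
... | tri≈ _ eq _  = eq
... | tri> _ _ m<l = contradiction m<l (second-≮ t s)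

-- Counting by injections.

module _ {A : Set} where

  unique⇒lookup-injective : {xs : List A} → Unique xs → ∀ i j → lookup xs i ≡ lookup xs j → i ≡ j
  unique⇒lookup-injective (x∉ ∷ u) zero    zero    eq = refl
  unique⇒lookup-injective (x∉ ∷ u) zero    (suc j) eq = contradiction eq (All.lookup x∉ (∈-lookup j))
  unique⇒lookup-injective (x∉ ∷ u) (suc i) zero    eq = contradiction (sym eq) (All.lookup x∉ (∈-lookup i))
  unique⇒lookup-injective (x∉ ∷ u) (suc i) (suc j) eq = cong suc (unique⇒lookup-injective u i j eq)

-- A relation takes the place of a map: images need only exist, and injectivity is derived from the
-- properties that `R` records.
length≤-by-injection : {A B : Set} (R : A → B → Set) {xs : List A} {ys : List B} → Unique xs →
  (∀ {x} → x ∈ xs → ∃[ y ] y ∈ ys × R x y) →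
  (∀ {x x′ y} → R x y → R x′ y → x ≡ x′) →
  length xs ≤ length ys
length≤-by-injection R {xs} {ys} unique image injective = injective⇒≤ {f = f} f-injective
  where
  f : Fin (length xs) → Fin (length ys)
  f i = index (proj₁ (proj₂ (image (∈-lookup i))))
  f-related : ∀ i → R (lookup xs i) (lookup ys (f i))
  f-related i with _ , y∈ , r ← image (∈-lookup i) = subst (R (lookup xs i)) (lookup-index y∈) r
  f-injective : ∀ {i j} → f i ≡ f j → i ≡ j
  f-injective {i} {j} eq = unique⇒lookup-injective unique i j
    (injective (f-related i) (subst (λ k → R (lookup xs j) (lookup ys k)) (sym eq) (f-related j)))

length-cartesianProduct : {A B : Set} (xs : List A) (ys : List B) →
  length (cartesianProduct xs ys) ≡ length xs * length ys
length-cartesianProduct []       ys = refl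
length-cartesianProduct (x ∷ xs) ys = trans (length-++ (map (x ,_) ys))
  (cong₂ _+_ (length-map (x ,_) ys) (length-cartesianProduct xs ys))

-- A repeated prefix has length O(√n).

-- The h * h subwords (start p < h, length h + t with t < h) of a repeated prefix of length 3h are
-- distinct, because their lengths exceed their starts, and repeated.
repeated-prefix⇒h²≤ : ∀ {h s l n} → 0 < s → s + l ≤ n → h + (h + h) ≤ l → Agree 0 s l → h * h ≤ suc n
repeated-prefix⇒h²≤ {h} {s} {l} {n} 0<s s+l≤n 3h≤l agree = begin
  h * h ≡⟨ cong₂ _*_ (length-upTo h) (length-upTo h) ⟨
  length (upTo h) * length (upTo h) ≡⟨ length-cartesianProduct (upTo h) (upTo h) ⟨
  length (cartesianProduct (upTo h) (upTo h)) ≤⟨ length≤-by-injection R (cartesianProduct⁺ (upTo⁺ h) (upTo⁺ h)) image injective ⟩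
  length (upTo (suc n)) ≡⟨ length-upTo (suc n) ⟩
  suc n ∎
  where
  open ≤-Reasoning
  -- Each word is sent to the start of its second occurrence, for which at most `suc n` values are
  -- possible.
  R : ℕ × ℕ → ℕ → Set
  R (p , t) q = p < h × Second q (h + t) × Agree q p (h + t)
  distinct : ∀ {p p′ q t} → R (p , t) q → R (p′ , t) q → ¬ p < p′
  distinct {p} {p′} {q} {t} (_ , _ , ag) (p′<h , _ , ag′) p<p′ = <⇒≱ p′<h
    (≤-trans (m≤m+n h t) (agree⇒length≤ p<p′ (agree-trans {b = q} (agree-sym {q} ag) ag′)))
  injective : ∀ {x x′ q} → R x q → R x′ q → x ≡ x′
  injective {p , t} {p′ , t′} {q} r@(_ , sec , _) r′@(_ , sec′ , _)
    with refl ← +-cancelˡ-≡ h t t′ (second-injective sec sec′) with <-cmp p p′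
  ... | tri< p<p′ _ _ = contradiction p<p′ (distinct {q = q} r r′)
  ... | tri≈ _ refl _ = refl
  ... | tri> _ _ p′<p = contradiction p′<p (distinct {q = q} r′ r)
  image : ∀ {x} → x ∈ cartesianProduct (upTo h) (upTo h) → ∃[ q ] q ∈ upTo (suc n) × R x q
  image {p , t} x∈
    with p∈ , t∈ ← ∈-cartesianProduct⁻ (upTo h) (upTo h) x∈
    with p<h ← ∈-upTo⁻ p∈ | t<h ← ∈-upTo⁻ t∈
    with u≤l ← ≤-trans (+-mono-≤ (<⇒≤ p<h) (+-monoʳ-≤ h (<⇒≤ t<h))) 3h≤l
    with q , q≤ , sec , ag ← second-exists {p} {s + p} {h + t} (m<n+m p 0<s)
           (agree-shift 0 s p (h + t) (agree-≤ u≤l agree))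
    = q , ∈-upTo⁺ (s≤s (≤-trans q≤ (≤-trans (+-monoʳ-≤ s (m+n≤o⇒m≤o p u≤l)) s+l≤n)))
      , p<h , sec , agree-trans {b = s + p} ag (agree-sym {p} (agree-shift 0 s p (h + t) (agree-≤ u≤l agree)))

-- Filters, duplicate-free lists and the enumeration of binary strings.

module _ {A : Set} where

  length-filter-¬ : {P : A → Set} (P? : Decidable P) → ∀ xs →
    length (filter P? xs) + length (filter (¬? ∘ P?) xs) ≡ length xs
  length-filter-¬ P? []       = refl
  length-filter-¬ P? (x ∷ xs) with P? x
  ... | yes _ = cong suc (length-filter-¬ P? xs)
  ... | no  _ = trans (+-suc _ _) (cong suc (length-filter-¬ P? xs))

  filter-filter : {P Q : A → Set} (P? : Decidable P) (Q? : Decidable Q) → ∀ xs →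
    filter Q? (filter P? xs) ≡ filter (λ x → P? x ×-dec Q? x) xs
  filter-filter P? Q? []       = refl
  filter-filter P? Q? (x ∷ xs) with P? x
  ... | no  _ = filter-filter P? Q? xs
  ... | yes _ with Q? x
  ...   | yes _ = cong (x ∷_) (filter-filter P? Q? xs)
  ...   | no  _ = filter-filter P? Q? xs

  distinct-members : {xs : List A} → Unique xs → 2 ≤ length xs → ∃[ x ] ∃[ y ] x ∈ xs × y ∈ xs × x ≢ y
  distinct-members {x ∷ y ∷ _} ((x≢y ∷ _) ∷ _) _ = x , y , here refl , there (here refl) , x≢y
  distinct-members {_ ∷ []} _ (s≤s ())

  2≤length : {xs : List A} {x y : A} → x ∈ xs → y ∈ xs → x ≢ y → 2 ≤ length xs
  2≤length x∈ y∈ x≢y = length≤-by-injection _≡_ ((x≢y ∷ []) ∷ [] ∷ [])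
    (λ { (here refl) → _ , x∈ , refl ; (there (here refl)) → _ , y∈ , refl })
    λ { refl refl → refl }

extend : Str → List Str
extend w = (false ∷ w) ∷ (true ∷ w) ∷ []

∈-extend : ∀ b w → b ∷ w ∈ extend w
∈-extend false w = here refl
∈-extend true  w = there (here refl)

∈-extend⁻ : ∀ {u w} → u ∈ extend w → ∃[ b ] u ≡ b ∷ w
∈-extend⁻ (here refl)         = false , refl
∈-extend⁻ (there (here refl)) = true , refl

∈-stringsOfLen : ∀ u → u ∈ stringsOfLen (length u)
∈-stringsOfLen []      = here refl
∈-stringsOfLen (b ∷ u) = ∈-concat⁺′ (∈-extend b u) (∈-map⁺ extend (∈-stringsOfLen u))

stringsOfLen⇒length : ∀ L {u} → u ∈ stringsOfLen L → length u ≡ L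
stringsOfLen⇒length zero    (here refl) = refl
stringsOfLen⇒length (suc L) u∈
  with vs , u∈vs , vs∈ ← ∈-concat⁻′ (map extend (stringsOfLen L)) u∈
  with w , w∈ , refl ← ∈-map⁻ extend vs∈
  with b , refl ← ∈-extend⁻ u∈vs = cong suc (stringsOfLen⇒length L w∈)

concatMap-unique : {A B : Set} (f : A → List B) {xs : List A} → Unique xs → (∀ x → Unique (f x)) →
  (∀ {x y b} → b ∈ f x → b ∈ f y → x ≡ y) → Unique (concatMap f xs)
concatMap-unique f unique unique-f injective = Unique.concat⁺
  (All.map⁺ (All.universal unique-f _))
  (AllPairs.map⁺ (AllPairs.map (λ { x≢y (b∈x , b∈y) → x≢y (injective b∈x b∈y) }) unique))

stringsOfLen-unique : ∀ L → Unique (stringsOfLen L)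
stringsOfLen-unique zero    = [] ∷ []
stringsOfLen-unique (suc L) = concatMap-unique extend (stringsOfLen-unique L)
  (λ _ → ((λ ()) ∷ []) ∷ [] ∷ [])
  λ b∈x b∈y → cong parent (trans (sym (proj₂ (∈-extend⁻ b∈x))) (proj₂ (∈-extend⁻ b∈y)))

stringsUpTo-unique : ∀ n → Unique (stringsUpTo n)
stringsUpTo-unique n = concatMap-unique stringsOfLen (upTo⁺ (suc n)) stringsOfLen-unique
  λ {L} {L′} u∈ u∈′ → trans (sym (stringsOfLen⇒length L u∈)) (stringsOfLen⇒length L′ u∈′)

∈-stringsUpTo : ∀ {n} u → length u ≤ n → u ∈ stringsUpTo n
∈-stringsUpTo u ≤n = ∈-concat⁺′ (∈-stringsOfLen u) (∈-map⁺ stringsOfLen (∈-upTo⁺ (s≤s ≤n)))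

-- Repeated words, and the bound on their number.

OccursAt : Str → ℕ → Set
OccursAt u i = word i (length u) ≡ u

startsAt? : ∀ n u → Decidable (λ i → sub (emPrefix n) i (length u) ≡ u)
startsAt? n u i = sub (emPrefix n) i (length u) ≟s u

repeated? : ∀ n → Decidable (λ u → 2 ≤ N n u)
repeated? n u = 2 ≤? N n u

repeated⇒occurrences : ∀ n u → 2 ≤ N n u →
  ∃[ p ] ∃[ q ] p < q × q + length u ≤ n × OccursAt u p × OccursAt u q
repeated⇒occurrences n u 2≤N = order (distinct-members (Unique.filter⁺ at? (upTo⁺ bound)) 2≤N)
  where
  bound = suc (length (emPrefix n) ∸ length u)
  at? = startsAt? n u
  starts = filter at? (upTo bound)
  ordered : ∀ {p q} → p ∈ starts → q ∈ starts → p < q →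
    ∃[ p ] ∃[ q ] p < q × q + length u ≤ n × OccursAt u p × OccursAt u q
  ordered {p} {q} p∈ q∈ p<q
    with p∈′ , at-p ← ∈-filter⁻ at? {xs = upTo bound} p∈ | q∈′ , at-q ← ∈-filter⁻ at? {xs = upTo bound} q∈
    = p , q , p<q , q+u≤n
    , trans (sym (sub-emPrefix n p _ (≤-trans (+-monoˡ-≤ (length u) (<⇒≤ p<q)) q+u≤n))) at-p
    , trans (sym (sub-emPrefix n q _ q+u≤n)) at-q
    where
    q≤ : q ≤ n ∸ length u
    q≤ = subst (λ m → q ≤ m ∸ length u) (length-emPrefix n) (s≤s⁻¹ (∈-upTo⁻ q∈′))
    -- Truncated subtraction would admit the start `0` for a word longer than `n`; since `p < q`,
    -- the start `q` is positive, which excludes this.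
    u<n : length u < n
    u<n = m∸n≢0⇒n<m (m<n⇒n≢0 (<-≤-trans p<q q≤))
    q+u≤n : q + length u ≤ n
    q+u≤n = m≤o∸n⇒m+n≤o q (<⇒≤ u<n) q≤
  order : (∃[ p ] ∃[ q ] p ∈ starts × q ∈ starts × p ≢ q) →
    ∃[ p ] ∃[ q ] p < q × q + length u ≤ n × OccursAt u p × OccursAt u q
  order (p , q , p∈ , q∈ , p≢q) with <-cmp p q
  ... | tri< p<q _ _ = ordered p∈ q∈ p<q
  ... | tri≈ _ eq _  = contradiction eq p≢q
  ... | tri> _ _ q<p = ordered q∈ p∈ q<p

occurrences⇒repeated : ∀ n u {p q} → p < q → q + length u ≤ n → OccursAt u p → OccursAt u q → 2 ≤ N n u
occurrences⇒repeated n u {p} {q} p<q q+u≤n at-p at-q =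
  2≤length (start (≤-trans (+-monoˡ-≤ (length u) (<⇒≤ p<q)) q+u≤n) at-p) (start q+u≤n at-q) (<⇒≢ p<q)
  where
  start : ∀ {i} → i + length u ≤ n → OccursAt u i →
    i ∈ filter (startsAt? n u) (upTo (suc (length (emPrefix n) ∸ length u)))
  start {i} i+u≤n at = ∈-filter⁺ (startsAt? n u)
    (∈-upTo⁺ (s≤s (subst (λ m → i ≤ m ∸ length u) (sym (length-emPrefix n)) (m+n≤o⇒m≤o∸n i i+u≤n))))
    (trans (sub-emPrefix n i _ i+u≤n) at)

Rn-unique : ∀ n → Unique (Rn n)
Rn-unique n = Unique.filter⁺ (repeated? n) (stringsUpTo-unique n)

-- The start of the second occurrence determines the length of a repeated word, hence the word
-- itself.
length-Rn≤ : ∀ n → length (Rn n) ≤ suc n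
length-Rn≤ n = ≤-trans (length≤-by-injection R (Rn-unique n) image injective) (≤-reflexive (length-upTo (suc n)))
  where
  R : Str → ℕ → Set
  R u q = OccursAt u q × Second q (length u)
  image : ∀ {u} → u ∈ Rn n → ∃[ q ] q ∈ upTo (suc n) × R u q
  image {u} u∈
    with p , q , p<q , q+u≤n , at-p , at-q ← repeated⇒occurrences n u (proj₂ (∈-filter⁻ (repeated? n) {xs = stringsUpTo n} u∈))
    with r , r≤q , second , agree ← second-exists p<q (word-injective p q _ (trans at-p (sym at-q)))
    = r , ∈-upTo⁺ (s≤s (≤-trans r≤q (m+n≤o⇒m≤o q q+u≤n))) , trans (word-cong r q _ agree) at-q , second
  injective : ∀ {u v q} → R u q → R v q → u ≡ v
  injective {q = q} (at-u , second-u) (at-v , second-v) =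
    trans (sym at-u) (trans (cong (word q) (second-injective second-u second-v)) at-v)

-- Suffixes of words as occurrences.

drop-word : ∀ a k l → drop k (word a (k + l)) ≡ word (a + k) l
drop-word a k l = trans (drop-applyUpTo _ k l) (applyUpTo-cong l (λ i _ → cong X (sym (+-assoc a k i))))

suffix⇒++ : ∀ {x w} → IsSuffix x w → ∃[ u ] w ≡ u ++ x
suffix⇒++ suffix with u Suffix.++ x≡ ← toView suffix = u , cong (u ++_) (sym (Pointwise-≡⇒≡ x≡))

suffix⇒occurrence : ∀ {x} a l → IsSuffix x (word a l) → ∃[ k ] k + length x ≡ l × OccursAt x (a + k)
suffix⇒occurrence {x} a l suffix with u , eq ← suffix⇒++ suffix = k , k+x≡l , occurs
  where
  k = length u
  k+x≡l : k + length x ≡ l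
  k+x≡l = trans (sym (length-++ u)) (trans (cong length (sym eq)) (length-word a l))
  occurs : OccursAt x (a + k)
  occurs = begin
    word (a + k) (length x)          ≡⟨ drop-word a k (length x) ⟨
    drop k (word a (k + length x))   ≡⟨ cong (drop k ∘ word a) k+x≡l ⟩
    drop k (word a l)                ≡⟨ cong (drop k) eq ⟩
    drop k (u ++ x)                  ≡⟨ drop-length-++ u ⟩
    x                                ∎
    where
    open ≡-Reasoning
    drop-length-++ : ∀ (u : Str) → drop (length u) (u ++ x) ≡ x
    drop-length-++ []      = refl
    drop-length-++ (_ ∷ u) = drop-length-++ u

occurrence⇒suffix : ∀ {x} a k → OccursAt x (a + k) → IsSuffix x (word a (k + length x))
occurrence⇒suffix {x} a k occurs = subst (IsSuffix x) split (u ++ˢ here (≡⇒Pointwise-≡ refl))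
  where
  u = take k (word a (k + length x))
  split : u ++ x ≡ word a (k + length x)
  split = trans (cong (u ++_) (trans (sym occurs) (sym (drop-word a k (length x)))))
    (take++drop≡id k (word a (k + length x)))

-- Times with the same longest match.

-- Equal left neighbours would prolong the match by one letter, against `longest`.
not-left-extendable : ∀ {n} (M : LongestMatch n) → let open LongestMatch M in
  ∀ {a} → suc a ≤ left → X a ≡ X left → ¬ Agree (suc a) (suc left) len
not-left-extendable {n} M {a} = go left ends longest
  where
  open LongestMatch M
  -- With `left` generalised to `b`, the bound `suc a ≤ b` exposes `b` as a successor, the form in
  -- which `longest` takes the start of the prolonged match.
  go : ∀ b → b + len ≡ n → (∀ a b l → a ≤ b → b + l ≡ n → Agree a (suc b) l → l ≤ len) →
    suc a ≤ b → X a ≡ X b → ¬ Agree (suc a) (suc b) len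
  go (suc b) b+len≡n longest (s≤s a≤b) Xa≡Xb agree =
    1+n≰n (longest a b (suc len) a≤b (trans (+-suc b len) b+len≡n) (agree-left Xa≡Xb agree))

-- If the earlier occurrence of the common match is not a prefix, it shares its left neighbour with
-- one of the two matches, since there are only two bits; that match could then be prolonged.
shared-match⇒prefix : ∀ {n n′} (M : LongestMatch n) (M′ : LongestMatch n′) →
  let module M = LongestMatch M; module M′ = LongestMatch M′ in
  n < n′ → M.len ≡ M′.len → Agree (suc M.left) (suc M′.left) M.len →
  X M.left ≢ X M′.left × Agree 0 (suc M.left) M.len
shared-match⇒prefix M M′ n<n′ refl agree = differ , prefix M.earlier refl
  where
  module M = LongestMatch M
  module M′ = LongestMatch M′
  left<left′ : M.left < M′.left
  left<left′ = +-cancelʳ-< M.len _ _ (subst₂ _<_ (sym M.ends) (sym M′.ends) n<n′)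
  differ : X M.left ≢ X M′.left
  differ eq = not-left-extendable M′ left<left′ eq agree
  prefix : ∀ e → M.earlier ≡ e → Agree 0 (suc M.left) M.len
  prefix zero    eq = subst (λ e → Agree e (suc M.left) M.len) eq M.agree
  prefix (suc e) eq with X e Bool.≟ X M.left
  ... | yes same = contradiction match (not-left-extendable M before same)
    where
    match : Agree (suc e) (suc M.left) M.len
    match = subst (λ e → Agree e (suc M.left) M.len) eq M.agree
    before = subst (_≤ M.left) eq M.before
  ... | no Xe≢ = contradiction (agree-trans {b = suc M.left} match agree)
      (not-left-extendable M′ (≤-trans before (<⇒≤ left<left′))
        (trans (¬-not Xe≢) (sym (¬-not (differ ∘ sym)))))
    where
    match : Agree (suc e) (suc M.left) M.len
    match = subst (λ e → Agree e (suc M.left) M.len) eq M.agree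
    before = subst (_≤ M.left) eq M.before

-- Naming times by their longest matches.

-- A name for the time n: its longest match, unless that is a prefix of the sequence. A prefix can
-- be the longest match at two times, and is then named together with the bit to its left.
-- The exceptional name is for the first occurrence of x, which the longest match does not cover.
data Name : Set where
  word-name   : Str → Name
  prefix-name : ℕ → Bool → Name
  exceptional : Name

module _ (c : Bool) (x′ : Str) where

  private
    x = c ∷ x′
    ℓ = length x′

    module M (i : ℕ) = LongestMatch (longestMatch (i + ℓ))

  -- The longest match at the end of the window of length |x| starting at i.
  matchWord : ℕ → Str
  matchWord i = word (suc (M.left i)) (M.len i)

  TooShort : ℕ → Set
  TooShort i = OccursAt x i × M.len i < length x

  Names : ℕ → Name → Set
  Names i (word-name w)     = matchWord i ≡ w × ¬ Agree 0 (suc (M.left i)) (M.len i)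
  Names i (prefix-name l b) = M.len i ≡ l × Agree 0 (suc (M.left i)) (M.len i) × X (M.left i) ≡ b
  Names i exceptional       = TooShort i

  -- A match shared by two times is a prefix, which rules out a common `word-name`. The two left
  -- bits then differ, which rules out a common `prefix-name`. At the later of two occurrences of
  -- `x` the longest match is at least as long as `x`, so it is not exceptional.
  names-≮ : ∀ {i j} y → Names i y → Names j y → ¬ i < j
  names-≮ {i} {j} (word-name _) (refl , ¬prefix) (eq , _) i<j =
    ¬prefix (proj₂ (shared-match⇒prefix (longestMatch (i + ℓ)) (longestMatch (j + ℓ)) (+-monoˡ-< ℓ i<j) len≡
      (word-injective _ _ _ (trans (sym eq) (cong (word (suc (M.left j))) (sym len≡))))))
    where
    len≡ : M.len i ≡ M.len j
    len≡ = trans (sym (length-word _ _)) (trans (cong length (sym eq)) (length-word _ _))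
  names-≮ {i} {j} (prefix-name _ _) (len≡ , prefix , Xi) (len≡′ , prefix′ , Xj) i<j =
    proj₁ (shared-match⇒prefix (longestMatch (i + ℓ)) (longestMatch (j + ℓ)) (+-monoˡ-< ℓ i<j) len≡len
      (agree-trans {b = 0} (agree-sym {0} prefix) (subst (Agree 0 _) (sym len≡len) prefix′)))
      (trans Xi (sym Xj))
    where
    len≡len = trans len≡ (sym len≡′)
  names-≮ {i} {suc j} exceptional (at-i , _) (at-j , short) (s≤s i≤j) =
    <⇒≱ short (M.longest (suc j) i j (length x) i≤j (+-suc j ℓ) (word-injective _ _ _ (trans at-i (sym at-j))))

  names-injective : ∀ {i j y} → Names i y → Names j y → i ≡ j
  names-injective {i} {j} {y} ni nj with <-cmp i j
  ... | tri< i<j _ _ = contradiction i<j (names-≮ y ni nj)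
  ... | tri≈ _ eq _  = eq
  ... | tri> _ _ j<i = contradiction j<i (names-≮ y nj ni)

  -- Match and window end together. Hence a match at least as long as `x` has `x` as a suffix
  -- exactly when `x` occurs in the window.
  matchWord-ends : ∀ i → suc (M.left i) + M.len i ≡ i + length x
  matchWord-ends i = trans (cong suc (M.ends i)) (sym (+-suc i ℓ))

  matchWord-repeated : ∀ {n} i → i + length x ≤ n → matchWord i ∈ Rn n
  matchWord-repeated {n} i i+x≤n = ∈-filter⁺ (repeated? n)
    (∈-stringsUpTo (matchWord i) (≤-trans (m≤n+m _ (suc (M.left i))) ends≤n))
    (occurrences⇒repeated n (matchWord i) (s≤s (M.before i)) ends≤n
      (trans (cong (word (M.earlier i)) length≡) (word-cong _ _ _ (M.agree i)))
      (cong (word (suc (M.left i))) length≡))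
    where
    length≡ : length (matchWord i) ≡ M.len i
    length≡ = length-word _ _
    ends≤n : suc (M.left i) + length (matchWord i) ≤ n
    ends≤n = ≤-trans (≤-reflexive (trans (cong (suc (M.left i) +_) length≡) (matchWord-ends i))) i+x≤n

  matchWord-suffix⇒occurs : ∀ i → IsSuffix x (matchWord i) → OccursAt x i
  matchWord-suffix⇒occurs i suffix
    with k , k+x≡len , occurs ← suffix⇒occurrence (suc (M.left i)) (M.len i) suffix
    = subst (OccursAt x) (+-cancelʳ-≡ (length x) _ _ (trans (+-assoc (suc (M.left i)) k _)
        (trans (cong (suc (M.left i) +_) k+x≡len) (matchWord-ends i)))) occurs

  occurs⇒matchWord-suffix : ∀ i → OccursAt x i → length x ≤ M.len i → IsSuffix x (matchWord i)
  occurs⇒matchWord-suffix i occurs x≤len =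
    subst (λ l → IsSuffix x (word (suc (M.left i)) l)) k+x≡len
      (occurrence⇒suffix (suc (M.left i)) k (subst (OccursAt x) (sym start≡) occurs))
    where
    k = M.len i ∸ length x
    k+x≡len : k + length x ≡ M.len i
    k+x≡len = m∸n+n≡m x≤len
    start≡ : suc (M.left i) + k ≡ i
    start≡ = +-cancelʳ-≡ (length x) _ _ (trans (+-assoc (suc (M.left i)) k _)
      (trans (cong (suc (M.left i) +_) k+x≡len) (matchWord-ends i)))

  -- Counting occurrences and non-occurrences of `x` at a fixed `n`.

  module _ {n h : ℕ} (h²>n : suc n < h * h) (x≤n : length x ≤ n) where

    starts : List ℕ
    starts = upTo (suc (length (emPrefix n) ∸ length x))

    starts⇒≤ : ∀ {i} → i ∈ starts → i + length x ≤ n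
    starts⇒≤ {i} i∈ = m≤o∸n⇒m+n≤o i x≤n (subst (λ m → i ≤ m ∸ length x) (length-emPrefix n) (s≤s⁻¹ (∈-upTo⁻ i∈)))

    length-starts : length starts + length x ≡ suc n
    length-starts = trans (cong (_+ length x) (trans (length-upTo _) (cong (λ m → suc (m ∸ length x)) (length-emPrefix n))))
      (cong suc (m∸n+n≡m x≤n))

    -- The names that are not words: one exceptional name, and a prefix length below 3h with one of
    -- two left bits.
    error : ℕ
    error = suc ((h + (h + h)) * 2)

    -- Names are injective on the selected starts, and besides the words of `ws` only `error` names
    -- are available. This serves both for the occurrences of `x` and for the other starts.
    length-filter-starts≤ : {P : ℕ → Set} (P? : Decidable P) (ws : List Str) →
      (∀ {i} → i + length x ≤ n → P i → TooShort i ⊎ matchWord i ∈ ws) →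
      length (filter P? starts) ≤ length ws + error
    length-filter-starts≤ P? ws named = ≤-trans
      (length≤-by-injection Names (Unique.filter⁺ P? (upTo⁺ _)) image names-injective) (≤-reflexive length-names)
      where
      lengths = upTo (h + (h + h))
      bits    = true ∷ false ∷ []
      names   = map word-name ws ++ exceptional ∷ map (uncurry prefix-name) (cartesianProduct lengths bits)
      length-names : length names ≡ length ws + error
      length-names = trans (length-++ (map word-name ws)) (cong₂ _+_ (length-map word-name ws) (cong suc
        (trans (length-map (uncurry prefix-name) (cartesianProduct lengths bits))
          (trans (length-cartesianProduct lengths bits) (cong (_* 2) (length-upTo (h + (h + h))))))))
      ∈-bits : ∀ b → b ∈ bits
      ∈-bits true  = here refl
      ∈-bits false = there (here refl)
      -- A repeated prefix of length 3h or more would force `h * h ≤ suc n`.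
      short : ∀ {i} → i + length x ≤ n → Agree 0 (suc (M.left i)) (M.len i) → M.len i < h + (h + h)
      short {i} i+x≤n prefix = ≰⇒> λ 3h≤len → <⇒≱ h²>n
        (repeated-prefix⇒h²≤ {h} {suc (M.left i)} z<s (≤-trans (≤-reflexive (matchWord-ends i)) i+x≤n) 3h≤len prefix)
      image : ∀ {i} → i ∈ filter P? starts → ∃[ y ] y ∈ names × Names i y
      image {i} i∈ with i∈′ , pi ← ∈-filter⁻ P? {xs = starts} i∈ with named (starts⇒≤ i∈′) pi
      ... | inj₁ tooShort = exceptional , ∈-++⁺ʳ (map word-name ws) (here refl) , tooShort
      ... | inj₂ w∈ with agree? 0 (suc (M.left i)) (M.len i)
      ...   | no ¬prefix = word-name (matchWord i) , ∈-++⁺ˡ (∈-map⁺ word-name w∈) , refl , ¬prefix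
      ...   | yes prefix = prefix-name (M.len i) (X (M.left i))
        , ∈-++⁺ʳ (map word-name ws) (there (∈-map⁺ (uncurry prefix-name)
            (∈-cartesianProduct⁺ (∈-upTo⁺ (short {i} (starts⇒≤ i∈′) prefix)) (∈-bits _))))
        , refl , prefix , refl

    private
      ends? : Decidable (IsSuffix x)
      ends? = isSuffix? x
      at? = startsAt? n x

    N≤ : N n x ≤ length (filter ends? (Rn n)) + error
    N≤ = length-filter-starts≤ at? (filter ends? (Rn n)) named
      where
      named : ∀ {i} → i + length x ≤ n → sub (emPrefix n) i (length x) ≡ x → TooShort i ⊎ matchWord i ∈ filter ends? (Rn n)
      named {i} i+x≤n at with length x ≤? M.len i
      ... | yes x≤len = inj₂ (∈-filter⁺ ends? (matchWord-repeated i i+x≤n) (occurs⇒matchWord-suffix i occurs x≤len))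
        where occurs = trans (sym (sub-emPrefix n i _ i+x≤n)) at
      ... | no x≰len  = inj₁ (trans (sym (sub-emPrefix n i _ i+x≤n)) at , ≰⇒> x≰len)

    non-occurrences≤ : length (filter (¬? ∘ at?) starts) ≤ length (filter (¬? ∘ ends?) (Rn n)) + error
    non-occurrences≤ = length-filter-starts≤ (¬? ∘ at?) (filter (¬? ∘ ends?) (Rn n)) λ {i} i+x≤n ¬at →
      inj₂ (∈-filter⁺ (¬? ∘ ends?) (matchWord-repeated i i+x≤n)
        λ suffix → ¬at (trans (sub-emPrefix n i _ i+x≤n) (matchWord-suffix⇒occurs i suffix)))

    -- The upper bound comes from complements. There are at most `suc n` repeated words and `suc n`
    -- minus |x| starts, and up to `error` the words not ending in `x` are at least as many as the
    -- starts where `x` does not occur.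
    Rn-suffix≤ : length (filter ends? (Rn n)) ≤ N n x + (error + length x)
    Rn-suffix≤ = +-cancelʳ-≤ (r̄ + N̄) _ _ (begin
      r + (r̄ + N̄)                      ≡⟨ +-assoc r r̄ N̄ ⟨
      r + r̄ + N̄                        ≡⟨ cong (_+ N̄) (length-filter-¬ ends? (Rn n)) ⟩
      length (Rn n) + N̄                ≤⟨ +-mono-≤ (length-Rn≤ n) non-occurrences≤ ⟩
      suc n + (r̄ + error)              ≡⟨ cong (_+ (r̄ + error)) length-starts ⟨
      length starts + length x + (r̄ + error) ≡⟨ cong (λ m → m + length x + (r̄ + error)) (length-filter-¬ at? starts) ⟨
      N n x + N̄ + length x + (r̄ + error) ≡⟨ solve 5 (λ a b c d e → a :+ b :+ c :+ (d :+ e) := a :+ (e :+ c) :+ (d :+ b)) refl (N n x) N̄ (length x) r̄ error ⟩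
      N n x + (error + length x) + (r̄ + N̄) ∎)
      where
      open ≤-Reasoning
      r = length (filter ends? (Rn n))
      r̄ = length (filter (¬? ∘ ends?) (Rn n))
      N̄ = length (filter (¬? ∘ at?) starts)

-- Passage to the limit.

dist≤ : ∀ {a b e} → a ≤ b + e → b ≤ a + e → dist a b ≤ e
dist≤ {a} {b} {e} a≤b+e b≤a+e with ≤-total a b
... | inj₁ a≤b rewrite m≤n⇒m∸n≡0 a≤b = m≤n+o⇒m∸n≤o b a b≤a+e
... | inj₂ b≤a rewrite m≤n⇒m∸n≡0 b≤a | +-identityʳ (a ∸ b) = m≤n+o⇒m∸n≤o a b a≤b+e

TnOfVertices≡RnOf : ∀ n x → TnOfVertices n x ≡ RnOf n x
TnOfVertices≡RnOf n x = filter-filter (repeated? n) (isSuffix? x) (stringsUpTo n)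

dist-RnOf-N≤ : ∀ {h n} c x → suc n < h * h → suc (length x) ≤ n →
  dist (length (RnOf n (c ∷ x))) (N n (c ∷ x)) ≤ suc ((h + (h + h)) * 2) + suc (length x)
dist-RnOf-N≤ {h} {n} c x h²>n x≤n = subst (λ ws → dist (length ws) (N n (c ∷ x)) ≤ _) (TnOfVertices≡RnOf n (c ∷ x))
  (dist≤ (Rn-suffix≤ c x {n} {h} h²>n x≤n)
    (≤-trans (N≤ c x {n} {h} h²>n x≤n) (+-monoʳ-≤ (length (TnOfVertices n (c ∷ x))) (m≤m+n _ (suc (length x))))))

theorem1 : (x : List Bool) → x ≢ [] →
    ((n : ℕ) → length (TnOfVertices n x) ≡ length (RnOf n x))
    × ((k : ℕ) → ∃[ M ] ((n : ℕ) → M ≤ n →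
    suc k * dist (length (RnOf n x)) (N n x) ≤ n))
theorem1 []      x≢[] = contradiction refl x≢[]
theorem1 (c ∷ x) _    = (λ n → cong length (TnOfVertices≡RnOf n (c ∷ x))) , λ k → bound k , eventually k
  where
  -- The bound on the distance is at most h * K k + C k after multiplication by 2 (k + 1); with
  -- h = n / K k this is at most 2n, while h * h > n + 1 for large n.
  K C bound : ℕ → ℕ
  K k = 12 * suc k
  C k = 2 * (suc k * suc (suc (length x)))
  bound k = suc (suc (K k)) * K k + C k
  eventually : ∀ k n → bound k ≤ n → suc k * dist (length (RnOf n (c ∷ x))) (N n (c ∷ x)) ≤ n
  eventually k n bound≤n = *-cancelˡ-≤ 2 (begin
    2 * (suc k * dist (length (RnOf n (c ∷ x))) (N n (c ∷ x)))
      ≤⟨ *-monoʳ-≤ 2 (*-monoʳ-≤ (suc k) (dist-RnOf-N≤ {h} {n} c x h²>n x≤n)) ⟩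
    2 * (suc k * (suc ((h + (h + h)) * 2) + suc (length x)))
      ≡⟨ solve 3 (λ k h l → con 2 :* (k :* (con 1 :+ (h :+ (h :+ h)) :* con 2 :+ (con 1 :+ l)))
           := h :* (con 12 :* k) :+ con 2 :* (k :* (con 2 :+ l))) refl (suc k) h (length x) ⟩
    h * K k + C k ≤⟨ +-mono-≤ (m/n*n≤m n (K k)) (m+n≤o⇒n≤o (suc (suc (K k)) * K k) bound≤n) ⟩
    n + n         ≡⟨ cong (n +_) (+-identityʳ n) ⟨
    2 * n         ∎)
    where
    open ≤-Reasoning
    h : ℕ
    h = n / K k
    -- The first summand of `bound k` makes the quotient `h` at least `K k + 2`.
    K<h : K k < h
    K<h = <-≤-trans (n<1+n _) (≤-trans (n≤1+n _) (subst (_≤ h) (m*n/n≡m (suc (suc (K k))) (K k))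
      (/-monoˡ-≤ (K k) (m+n≤o⇒m≤o (suc (suc (K k)) * K k) bound≤n))))
    h²>n : suc n < h * h
    h²>n = begin-strict
      suc n                   ≡⟨ cong suc (m≡m%n+[m/n]*n n (K k)) ⟩
      suc (n % K k) + h * K k ≤⟨ +-monoˡ-≤ (h * K k) (m%n<n n (K k)) ⟩
      K k + h * K k           <⟨ +-monoˡ-< (h * K k) K<h ⟩
      h + h * K k             ≡⟨ *-suc h (K k) ⟨
      h * suc (K k)           ≤⟨ *-monoʳ-≤ h K<h ⟩
      h * h                   ∎
    x≤n : suc (length x) ≤ n
    x≤n = begin
      suc (length x)                         ≤⟨ n≤1+n _ ⟩
      suc (suc (length x))                   ≤⟨ m≤n*m _ (suc k) ⟩
      suc k * suc (suc (length x))           ≤⟨ m≤n*m _ 2 ⟩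
      2 * (suc k * suc (suc (length x)))     ≤⟨ m+n≤o⇒n≤o (suc (suc (K k)) * K k) bound≤n ⟩
      n                                      ∎
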